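{- Let $W=W(A_n)$ with generators $s_1,\dots,s_n$ ($s_i$, $s_j$ commuting iff $|i-j|\ge2$, and $s_is_{i+1}s_i=s_{i+1}s_is_{i+1}$). Let $w=s_1s_2\cdots s_{n-1}s_ns_{n-1}\cdots s_2s_1$ (this expression is reduced), and let $x\in W$ be a Coxeter element, i.e. $x=s_{\pi(1)}s_{\pi(2)}\cdots s_{\pi(n)}$ for some permutation $\pi$ of $\{1,\dots,n\}$. Then: (i) $x\le w$; (ii) the Bruhat interval $[x,w]$ is isomorphic, as a poset, to the Boolean lattice of rank $\ell(w)-\ell(x)$; (iii) every $y\in W$ with $x<y\le w$ is not fully commutative.
   Context: $\ell$ is the Coxeter length and $\le$ the Bruhat order on $W$. An element of $W$ is fully commutative if any two of its reduced expressions are related by a sequence of moves $ss'\leftrightarrow s's$ with $s,s'$ commuting generators. -}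

module Defs where

open import Level using (0ℓ)
open import Algebra.Bundles using (Group)
open import Data.Fin.Base using (Fin; toℕ; fromℕ; inject₁)
open import Data.Fin.Permutation using (Permutation′; _⟨$⟩ʳ_)
open import Data.List.Base
  using (List; []; _∷_; [_]; _++_; map; length; reverse; allFin; tabulate)
open import Data.List.Properties
  using (++-assoc; ++-identityʳ; reverse-++; unfold-reverse)
open import Data.Nat.Base as ℕ using (ℕ; suc; ∣_-_∣)
import Data.Nat.Properties as ℕ
open import Data.Product.Base using (_×_; _,_; proj₁; ∃-syntax; Σ-syntax)
open import Data.Sum.Base using (_⊎_; inj₁; inj₂)
open import Relation.Binary.Bundles using (Poset)
open import Relation.Binary.Core using (Rel)
open import Relation.Binary.Construct.Closure.Equivalence using (EqClosure)
open import Relation.Binary.Construct.Closure.Transitive as ⁺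
  using (TransClosure; _∷_)
import Relation.Binary.Construct.On as On
open import Relation.Binary.Morphism.Structures using (IsOrderIsomorphism)
import Relation.Binary.Properties.Poset as PosetProperties
open import Relation.Binary.PropositionalEquality as ≡ using (_≡_)
open import Relation.Nullary.Negation using (¬_; contradiction)

------------------------------------------------------------------------
-- The Coxeter group of type A, by generators and relations

-- The generator sᵢ is represented by the element of Fin n with value i - 1.
-- Since generators are involutions, words without inverses suffice.

Word : ℕ → Set
Word n = List (Fin n)

Commuting : ∀ {n} → Rel (Fin n) 0ℓ
Commuting i j = 2 ℕ.≤ ∣ toℕ i - toℕ j ∣

infix 4 _≈_

data _≈_ {n : ℕ} : Rel (Word n) 0ℓ where
  ≈-refl     : ∀ {u} → u ≈ u
  ≈-sym      : ∀ {u v} → u ≈ v → v ≈ u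
  ≈-trans    : ∀ {u v w} → u ≈ v → v ≈ w → u ≈ w
  ++-cong    : ∀ {u u′ v v′} → u ≈ u′ → v ≈ v′ → u ++ v ≈ u′ ++ v′
  involution : ∀ i → i ∷ i ∷ [] ≈ []
  commute    : ∀ {i j} → Commuting i j → i ∷ j ∷ [] ≈ j ∷ i ∷ []
  braid      : ∀ {i j} → toℕ j ≡ suc (toℕ i) →
               i ∷ j ∷ i ∷ [] ≈ j ∷ i ∷ j ∷ []

≈-reflexive : ∀ {n} {u v : Word n} → u ≡ v → u ≈ v
≈-reflexive ≡.refl = ≈-refl

++-reverseʳ : ∀ {n} (u : Word n) → u ++ reverse u ≈ []
++-reverseʳ []      = ≈-refl
++-reverseʳ (i ∷ u) =
  ≈-trans (≈-reflexive (≡.cong (i ∷_) (≡.trans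
            (≡.cong (u ++_) (unfold-reverse i u))
            (≡.sym (++-assoc u (reverse u) [ i ])))))
  (≈-trans (++-cong (≈-refl {u = [ i ]}) (++-cong (++-reverseʳ u) ≈-refl))
           (involution i))

reverse-cong : ∀ {n} {u v : Word n} → u ≈ v → reverse u ≈ reverse v
reverse-cong ≈-refl          = ≈-refl
reverse-cong (≈-sym p)       = ≈-sym (reverse-cong p)
reverse-cong (≈-trans p q)   = ≈-trans (reverse-cong p) (reverse-cong q)
reverse-cong (++-cong {u} {u′} {v} {v′} p q) =
  ≈-trans (≈-reflexive (reverse-++ u v))
  (≈-trans (++-cong (reverse-cong q) (reverse-cong p))
           (≈-reflexive (≡.sym (reverse-++ u′ v′))))
reverse-cong (involution i)  = involution i
reverse-cong (commute c)     = ≈-sym (commute c)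
reverse-cong (braid e)       = braid e

++-reverseˡ : ∀ {n} (u : Word n) → reverse u ++ u ≈ []
++-reverseˡ []      = ≈-refl
++-reverseˡ (i ∷ u) =
  ≈-trans (≈-reflexive (≡.trans
            (≡.cong (_++ i ∷ u) (unfold-reverse i u))
            (++-assoc (reverse u) [ i ] (i ∷ u))))
  (≈-trans (++-cong (≈-refl {u = reverse u})
                    (++-cong (involution i) (≈-refl {u = u})))
           (++-reverseˡ u))

W : ℕ → Group 0ℓ 0ℓ
W n = record
  { Carrier = Word n
  ; _≈_     = _≈_
  ; _∙_     = _++_
  ; ε       = []
  ; _⁻¹     = reverse
  ; isGroup = record
    { isMonoid = record
      { isSemigroup = record
        { isMagma = record
          { isEquivalence = record
            { refl = ≈-refl ; sym = ≈-sym ; trans = ≈-trans }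
          ; ∙-cong = ++-cong
          }
        ; assoc = λ u v w → ≈-reflexive (++-assoc u v w)
        }
      ; identity = (λ _ → ≈-refl) , (λ u → ≈-reflexive (++-identityʳ u))
      }
    ; inverse = ++-reverseˡ , ++-reverseʳ
    ; ⁻¹-cong = reverse-cong
    }
  }

------------------------------------------------------------------------
-- Reduced expressions and length

Reduced : ∀ {n} → Word n → Set
Reduced u = ∀ v → v ≈ u → length u ℕ.≤ length v

ReducedExpression : ∀ {n} → Word n → Word n → Set
ReducedExpression w u = u ≈ w × Reduced u

-- HasLength w k says ℓ(w) = k.  The length is a (single-valued) relation
-- because computing it would require solving the word problem.

HasLength : ∀ {n} → Word n → ℕ → Set
HasLength w k = ∃[ u ] ReducedExpression w u × length u ≡ k

HasLength-unique : ∀ {n} {w w′ : Word n} {k k′} →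
                   w ≈ w′ → HasLength w k → HasLength w′ k′ → k ≡ k′
HasLength-unique w≈w′ (u , (u≈w , ru) , ≡.refl) (v , (v≈w′ , rv) , ≡.refl) =
  ℕ.≤-antisym (ru v (≈-sym u≈v)) (rv u u≈v)
  where u≈v = ≈-trans u≈w (≈-trans w≈w′ (≈-sym v≈w′))

HasLength-resp : ∀ {n} {w w′ : Word n} {k} →
                 w ≈ w′ → HasLength w k → HasLength w′ k
HasLength-resp w≈w′ (u , (u≈w , ru) , e) = u , (≈-trans u≈w w≈w′ , ru) , e

------------------------------------------------------------------------
-- Bruhat order

module _ {n : ℕ} where
  open Group (W n) using (_∙_; _⁻¹)

  IsReflection : Word n → Set
  IsReflection t = ∃[ u ] ∃[ i ] t ≈ u ∙ [ i ] ∙ u ⁻¹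

  infix 4 _⟶_ _≤_

  -- v = ut for a reflection t, and ℓ(u) < ℓ(v).
  _⟶_ : Rel (Word n) 0ℓ
  u ⟶ v = (∃[ t ] IsReflection t × v ≈ u ∙ t)
        × (∃[ k ] ∃[ l ] HasLength u k × HasLength v l × k ℕ.< l)

  _≤_ : Rel (Word n) 0ℓ
  u ≤ v = u ≈ v ⊎ TransClosure _⟶_ u v

  private
    ⟶-respˡ : ∀ {u u′ v} → u ≈ u′ → u ⟶ v → u′ ⟶ v
    ⟶-respˡ e ((t , rt , q) , (k , l , hu , hv , k<l)) =
      (t , rt , ≈-trans q (++-cong e ≈-refl)) ,
      (k , l , HasLength-resp e hu , hv , k<l)

    ⟶-respʳ : ∀ {u v v′} → v ≈ v′ → u ⟶ v → u ⟶ v′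
    ⟶-respʳ e ((t , rt , q) , (k , l , hu , hv , k<l)) =
      (t , rt , ≈-trans (≈-sym e) q) ,
      (k , l , hu , HasLength-resp e hv , k<l)

    ⁺-respˡ : ∀ {u u′ v} → u ≈ u′ → TransClosure _⟶_ u v → TransClosure _⟶_ u′ v
    ⁺-respˡ e ⁺.[ p ]  = ⁺.[ ⟶-respˡ e p ]
    ⁺-respˡ e (p ∷ ps) = ⟶-respˡ e p ∷ ps

    ⁺-respʳ : ∀ {u v v′} → v ≈ v′ → TransClosure _⟶_ u v → TransClosure _⟶_ u v′
    ⁺-respʳ e ⁺.[ p ]  = ⁺.[ ⟶-respʳ e p ]
    ⁺-respʳ e (p ∷ ps) = p ∷ ⁺-respʳ e ps

    ⁺-length : ∀ {u v} → TransClosure _⟶_ u v →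
               ∃[ k ] ∃[ l ] HasLength u k × HasLength v l × k ℕ.< l
    ⁺-length ⁺.[ _ , h ] = h
    ⁺-length ((_ , (k , l , hu , hv , k<l)) ∷ ps)
      with k′ , l′ , hv′ , hw , k′<l′ ← ⁺-length ps
      with ≡.refl ← HasLength-unique ≈-refl hv hv′ =
      k , l′ , hu , hw , ℕ.<-trans k<l k′<l′

    ⁺-irrefl : ∀ {u} → ¬ TransClosure _⟶_ u u
    ⁺-irrefl p with k , l , hu , hu′ , k<l ← ⁺-length p =
      ℕ.<-irrefl (HasLength-unique ≈-refl hu hu′) k<l

  ≤-trans : ∀ {u v w} → u ≤ v → v ≤ w → u ≤ w
  ≤-trans (inj₁ p) (inj₁ q) = inj₁ (≈-trans p q)
  ≤-trans (inj₁ p) (inj₂ q) = inj₂ (⁺-respˡ (≈-sym p) q)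
  ≤-trans (inj₂ p) (inj₁ q) = inj₂ (⁺-respʳ q p)
  ≤-trans (inj₂ p) (inj₂ q) = inj₂ (p ⁺.++ q)

  ≤-antisym : ∀ {u v} → u ≤ v → v ≤ u → u ≈ v
  ≤-antisym (inj₁ p) _        = p
  ≤-antisym (inj₂ p) (inj₁ q) = ≈-sym q
  ≤-antisym (inj₂ p) (inj₂ q) = contradiction (p ⁺.++ q) ⁺-irrefl

Bruhat : ℕ → Poset 0ℓ 0ℓ 0ℓ
Bruhat n = record
  { Carrier        = Word n
  ; _≈_            = _≈_
  ; _≤_            = _≤_
  ; isPartialOrder = record
    { isPreorder = record
      { isEquivalence = Group.isEquivalence (W n)
      ; reflexive     = inj₁
      ; trans         = ≤-trans
      }
    ; antisym = ≤-antisym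
    }
  }

infix 4 _<_

_<_ : ∀ {n} → Rel (Word n) 0ℓ
_<_ {n} = PosetProperties._<_ (Bruhat n)

------------------------------------------------------------------------
-- Intervals and isomorphisms of posets

Interval : (P : Poset 0ℓ 0ℓ 0ℓ) (a b : Poset.Carrier P) → Poset 0ℓ 0ℓ 0ℓ
Interval P a b = On.poset P (proj₁ {B = λ y → a P.≤ y × y P.≤ b})
  where module P = Poset P

infix 4 _≅_

_≅_ : Rel (Poset 0ℓ 0ℓ 0ℓ) 0ℓ
P ≅ Q = Σ[ f ∈ (P.Carrier → Q.Carrier) ]
          IsOrderIsomorphism P._≈_ Q._≈_ P._≤_ Q._≤_ f
  where module P = Poset P
        module Q = Poset Q

------------------------------------------------------------------------
-- Fully commutative elements and Coxeter elements

data CommutationMove {n : ℕ} : Rel (Word n) 0ℓ where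
  move : ∀ u {i j} v → Commuting i j →
         CommutationMove (u ++ i ∷ j ∷ v) (u ++ j ∷ i ∷ v)

FullyCommutative : ∀ {n} → Word n → Set
FullyCommutative w =
  ∀ u v → ReducedExpression w u → ReducedExpression w v →
  EqClosure CommutationMove u v

IsCoxeterElement : ∀ {n} → Word n → Set
IsCoxeterElement {n} x =
  Σ[ π ∈ Permutation′ n ] x ≈ tabulate (π ⟨$⟩ʳ_)

-- s₁ s₂ ⋯ sₙ₋₁ sₙ sₙ₋₁ ⋯ s₂ s₁ with n = suc m.
palindrome : ∀ m → Word (suc m)
palindrome m = initial ++ [ fromℕ m ] ++ reverse initial
  where initial = map inject₁ (allFin m)

{-# OPTIONS --safe #-}

-- Every Coxeter element x has an expression in which each sᵢ stands to the left
-- or to the right of all sⱼ with j > i, so it is a subword of the palindrome w.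
-- By strong exchange, the elements of [x, w] are the subwords of w that still
-- contain x; these arise by choosing the set S of those i < n for which sᵢ is
-- kept on both sides.  The permutations they induce show that they are reduced
-- and that S can be recovered, and that S ⊆ S′ whenever the word of S is a
-- subword of that of S′.  If S is nonempty and i is its largest element, then
-- the two copies of sᵢ can be moved next to the only sᵢ₊₁, giving a braid.

module Submission where

open import Algebra.Bundles using (Group)
import Algebra.Properties.CommutativeSemigroup as CommutativeSemigroupProperties
import Algebra.Properties.Group as GroupProperties
open import Data.Bool.Base using (Bool; true; false; not; _∨_; b≤b; f≤t) renaming (_≤_ to _≤ᵇ_)
open import Data.Bool.Properties using (∨-zeroʳ) renaming (_≟_ to _≟ᵇ_)
open import Data.Fin.Base using (Fin; zero; suc; toℕ; fromℕ; inject₁)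
open import Data.Fin.Permutation using (_⟨$⟩ʳ_; _⟨$⟩ˡ_; inverseʳ)
open import Data.Fin.Properties using (toℕ-injective)
open import Data.Fin.Subset using (Subset; inside; outside; ⊥; ⊤; ∣_∣) renaming (_⊆_ to _⊆ˢ_)
open import Data.Fin.Subset.Properties
  using (⊆-poset; ⊆-antisym; ⊆-min; ⊆-max; out⊆; in⊆in; drop-∷-⊆; ∣⊤∣≡n; ∣⊥∣≡0)
open import Data.List.Base
  using ([]; _∷_; [_]; _++_; _∷ʳ_; map; length; reverse; tabulate; allFin)
open import Data.List.Membership.Propositional using (_∈_; _∉_)
open import Data.List.Membership.Propositional.Properties
  using (∈-∃++; ∈-++⁺ˡ; ∈-++⁺ʳ; ∈-++⁻; ∈-map⁻; ∈-tabulate⁺)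
open import Data.List.Properties
  using (++-assoc; ++-identityʳ; map-++; reverse-++; reverse-involutive; length-++;
         length-++-comm; length-map; map-tabulate; reverse-map; unfold-reverse)
open import Data.List.Relation.Binary.Permutation.Propositional as ↭ using (_↭_)
import Data.List.Relation.Binary.Permutation.Propositional.Properties as ↭
open import Data.List.Relation.Binary.Sublist.Propositional
  using (_⊆_; []; _∷_; ⊆-refl; ⊆-trans) renaming (_∷ʳ_ to _∷ˢ_)
open import Data.List.Relation.Binary.Sublist.Propositional.Properties
  using (All-resp-⊆; ++⁺; ++⁺ˡ)
open import Data.List.Relation.Unary.All as All using ([]; _∷_)
open import Data.List.Relation.Unary.Any using (here; there)
open import Data.List.Relation.Unary.Unique.Propositional using (Unique; []; _∷_)
import Data.List.Relation.Unary.Unique.Propositional.Properties as Unique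
open import Data.Nat.Base as ℕ using (ℕ; zero; suc; _+_; _∸_; z≤n; s≤s)
open import Data.Nat.ListAction using (sum)
open import Data.Nat.ListAction.Properties using (sum-++; sum-↭)
import Data.Nat.Properties as ℕ
open import Data.Product.Base using (_×_; _,_; proj₁; proj₂; ∃-syntax)
open import Data.Sum.Base using (inj₁; inj₂)
open import Data.Vec.Base using (Vec; []; _∷_; here; replicate)
open import Data.Vec.Properties using (≡-dec)
open import Function.Base using (_∘_; id)
open import Function.Bundles using (Injection)
open import Function.Properties.Inverse using (↔⇒↣)
open import Relation.Binary.Bundles using (Poset)
import Relation.Binary.Construct.Closure.Equivalence as Eq
open import Relation.Binary.Construct.Closure.ReflexiveTransitive as Star using (Star; ε; _◅_)
open import Relation.Binary.Construct.Closure.Transitive as ⁺ using (TransClosure; _∷_)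
open import Relation.Binary.Definitions using (tri<; tri≈; tri>)
open import Relation.Binary.PropositionalEquality as ≡
  using (_≡_; _≢_; _≗_; refl; sym; trans; cong; cong₂; subst; subst₂; module ≡-Reasoning)
import Relation.Binary.Reasoning.Setoid as SetoidReasoning
open import Relation.Nullary.Decidable using (yes; no)
open import Relation.Nullary.Negation using (¬_; contradiction)
open import Defs

open CommutativeSemigroupProperties ℕ.+-commutativeSemigroup using (x∙yz≈y∙xz)

module _ {n : ℕ} where
  open Group (W n) public using () renaming (setoid to W-setoid)
  open GroupProperties (W n) public using (∙-cancelˡ; ∙-cancelʳ)

++-congˡ : ∀ {n} (u : Word n) {v v′} → v ≈ v′ → u ++ v ≈ u ++ v′
++-congˡ u = ++-cong (≈-refl {u = u})

++-congʳ : ∀ {n} {u u′ : Word n} v → u ≈ u′ → u ++ v ≈ u′ ++ v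
++-congʳ v p = ++-cong p (≈-refl {u = v})

-- Words as permutations of ℕ

-- Acting on all of ℕ, with the points above `n` fixed, avoids a change of domain when letters are
-- shifted.
swap : ∀ {n} → Fin n → ℕ → ℕ
swap zero    zero          = 1
swap zero    (suc zero)    = 0
swap zero    (suc (suc k)) = suc (suc k)
swap (suc i) zero          = 0
swap (suc i) (suc k)       = suc (swap i k)

swap-involutive : ∀ {n} (i : Fin n) k → swap i (swap i k) ≡ k
swap-involutive zero    zero          = refl
swap-involutive zero    (suc zero)    = refl
swap-involutive zero    (suc (suc k)) = refl
swap-involutive (suc i) zero          = refl
swap-involutive (suc i) (suc k)       = cong suc (swap-involutive i k)

swap-comm : ∀ {n} (i j : Fin n) → Commuting i j →
            ∀ k → swap i (swap j k) ≡ swap j (swap i k)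
swap-comm zero    (suc zero)    (s≤s ())
swap-comm zero    (suc (suc j)) _ zero          = refl
swap-comm zero    (suc (suc j)) _ (suc zero)    = refl
swap-comm zero    (suc (suc j)) _ (suc (suc k)) = refl
swap-comm (suc zero)    zero    (s≤s ())
swap-comm (suc (suc i)) zero    _ zero          = refl
swap-comm (suc (suc i)) zero    _ (suc zero)    = refl
swap-comm (suc (suc i)) zero    _ (suc (suc k)) = refl
swap-comm (suc i) (suc j) c zero    = refl
swap-comm (suc i) (suc j) c (suc k) = cong suc (swap-comm i j c k)

swap-braid : ∀ {n} (i j : Fin n) → toℕ j ≡ suc (toℕ i) →
             ∀ k → swap i (swap j (swap i k)) ≡ swap j (swap i (swap j k))
swap-braid zero    (suc zero) _ zero                = refl
swap-braid zero    (suc zero) _ (suc zero)          = refl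
swap-braid zero    (suc zero) _ (suc (suc zero))    = refl
swap-braid zero    (suc zero) _ (suc (suc (suc k))) = refl
swap-braid (suc i) (suc j)    _ zero                = refl
swap-braid (suc i) (suc j)    e (suc k)             =
  cong suc (swap-braid i j (ℕ.suc-injective e) k)

swap-lower : ∀ {n} (i : Fin n) → swap i (toℕ i) ≡ suc (toℕ i)
swap-lower zero    = refl
swap-lower (suc i) = cong suc (swap-lower i)

swap-upper : ∀ {n} (i : Fin n) → swap i (suc (toℕ i)) ≡ toℕ i
swap-upper zero    = refl
swap-upper (suc i) = cong suc (swap-upper i)

swap-fixes : ∀ {n} (i : Fin n) {k} → k ≢ toℕ i → k ≢ suc (toℕ i) → swap i k ≡ k
swap-fixes zero    {zero}        p q = contradiction refl p
swap-fixes zero    {suc zero}    p q = contradiction refl q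
swap-fixes zero    {suc (suc k)} p q = refl
swap-fixes (suc i) {zero}        p q = refl
swap-fixes (suc i) {suc k}       p q = cong suc (swap-fixes i (p ∘ cong suc) (q ∘ cong suc))

swap-injective : ∀ {n} (i : Fin n) {a b} → swap i a ≡ swap i b → a ≡ b
swap-injective i {a} {b} e =
  trans (sym (swap-involutive i a)) (trans (cong (swap i) e) (swap-involutive i b))

-- An adjacent transposition has a single inversion; in the exchange property this identifies the
-- letter to delete.
swap-inverts : ∀ {n} (i : Fin n) {a b} → a ℕ.< b → swap i b ℕ.< swap i a →
               a ≡ toℕ i × b ≡ suc (toℕ i)
swap-inverts zero {zero}        {suc zero}    _   _ = refl , refl
swap-inverts zero {zero}        {suc (suc b)} _   (s≤s ())
swap-inverts zero {suc zero}    {suc zero}    (s≤s ()) _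
swap-inverts zero {suc zero}    {suc (suc b)} _   ()
swap-inverts zero {suc (suc a)} {suc zero}    (s≤s ()) _
swap-inverts zero {suc (suc a)} {suc (suc b)} a<b b<a = contradiction b<a (ℕ.<-asym a<b)
swap-inverts (suc i) {zero}  {suc b} _ ()
swap-inverts (suc i) {suc a} {suc b} (s≤s a<b) (s≤s b<a)
  with refl , refl ← swap-inverts i a<b b<a = refl , refl

⟦_⟧ : ∀ {n} → Word n → ℕ → ℕ
⟦ []    ⟧ k = k
⟦ i ∷ u ⟧ k = swap i (⟦ u ⟧ k)

⟦⟧-++ : ∀ {n} (u v : Word n) k → ⟦ u ++ v ⟧ k ≡ ⟦ u ⟧ (⟦ v ⟧ k)
⟦⟧-++ []      v k = refl
⟦⟧-++ (i ∷ u) v k = cong (swap i) (⟦⟧-++ u v k)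

-- The defining relations hold for adjacent transpositions, so the action descends to the group; the
-- converse is `faithful`.
⟦⟧-cong : ∀ {n} {u v : Word n} → u ≈ v → ⟦ u ⟧ ≗ ⟦ v ⟧
⟦⟧-cong ≈-refl         k = refl
⟦⟧-cong (≈-sym p)      k = sym (⟦⟧-cong p k)
⟦⟧-cong (≈-trans p q)  k = trans (⟦⟧-cong p k) (⟦⟧-cong q k)
⟦⟧-cong (++-cong {u} {u′} {v} {v′} p q) k =
  trans (⟦⟧-++ u v k) (trans (⟦⟧-cong p (⟦ v ⟧ k))
  (trans (cong ⟦ u′ ⟧ (⟦⟧-cong q k)) (sym (⟦⟧-++ u′ v′ k))))
⟦⟧-cong (involution i) k = swap-involutive i k
⟦⟧-cong (commute {i} {j} c) k = swap-comm i j c k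
⟦⟧-cong (braid {i} {j} e)   k = swap-braid i j e k

⟦⟧-injective : ∀ {n} (u : Word n) {a b} → ⟦ u ⟧ a ≡ ⟦ u ⟧ b → a ≡ b
⟦⟧-injective []      e = e
⟦⟧-injective (i ∷ u) e = ⟦⟧-injective u (swap-injective i e)

-- The parabolic subgroup generated by all generators but the first

shift : ∀ {n} → Word n → Word (suc n)
shift = map suc

⟦shift⟧-zero : ∀ {n} (u : Word n) → ⟦ shift u ⟧ 0 ≡ 0
⟦shift⟧-zero []      = refl
⟦shift⟧-zero (i ∷ u) = cong (swap (suc i)) (⟦shift⟧-zero u)

⟦shift⟧-suc : ∀ {n} (u : Word n) k → ⟦ shift u ⟧ (suc k) ≡ suc (⟦ u ⟧ k)
⟦shift⟧-suc []      k = refl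
⟦shift⟧-suc (i ∷ u) k = cong (swap (suc i)) (⟦shift⟧-suc u k)

shift-cong : ∀ {n} {u v : Word n} → u ≈ v → shift u ≈ shift v
shift-cong ≈-refl         = ≈-refl
shift-cong (≈-sym p)      = ≈-sym (shift-cong p)
shift-cong (≈-trans p q)  = ≈-trans (shift-cong p) (shift-cong q)
shift-cong (++-cong {u} {u′} {v} {v′} p q) =
  ≈-trans (≈-reflexive (map-++ suc u v))
  (≈-trans (++-cong (shift-cong p) (shift-cong q))
           (≈-reflexive (sym (map-++ suc u′ v′))))
shift-cong (involution i) = involution (suc i)
shift-cong (commute c)    = commute c
shift-cong (braid e)      = braid (cong suc e)

-- A double shift has only letters from 2 on, and these all commute with 0.
zero-comm-shift² : ∀ {n} (u : Word n) →
                   zero ∷ shift (shift u) ≈ shift (shift u) ∷ʳ zero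
zero-comm-shift² []      = ≈-refl
zero-comm-shift² (i ∷ u) =
  ≈-trans (++-congʳ (shift (shift u)) (commute {i = zero} {j = suc (suc i)} (s≤s (s≤s z≤n))))
          (++-congˡ [ suc (suc i) ] (zero-comm-shift² u))

-- Faithfulness of the permutation action

-- descent k = sₖ₋₁ ⋯ s₁ s₀, the representative of the coset of the subgroup
-- ⟨s₁, s₂, …⟩ (the stabiliser of 0) whose elements send 0 to k.
descent : ∀ {n} → Fin (suc n) → Word n
descent         zero    = []
descent {suc n} (suc k) = shift (descent k) ∷ʳ zero

⟦descent⟧-zero : ∀ {n} (k : Fin (suc n)) → ⟦ descent k ⟧ 0 ≡ toℕ k
⟦descent⟧-zero         zero    = refl
⟦descent⟧-zero {suc n} (suc k) =
  trans (⟦⟧-++ (shift (descent k)) [ zero ] 0)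
  (trans (⟦shift⟧-suc (descent k) 0) (cong suc (⟦descent⟧-zero k)))

-- Left multiplication by a generator permutes the cosets: it turns one representative into another,
-- up to a factor in the stabiliser of 0.
∷-descent : ∀ {n} (i : Fin (suc n)) (k : Fin (suc (suc n))) →
            ∃[ l ] ∃[ v ] i ∷ descent k ≈ descent l ++ shift v
∷-descent zero    zero = suc zero , [] , ≈-refl
∷-descent (suc i) zero = zero , [ i ] , ≈-refl
∷-descent zero (suc zero) = zero , [] , involution zero
-- The letter 0 passes the double shift and meets 1, 0; the braid relation then leaves a 1 at the
-- right end, which lies in the shifted subgroup.
∷-descent {suc n} zero (suc (suc k)) = suc (suc k) , [ zero ] , (begin
  zero ∷ shift (shift d ∷ʳ zero) ∷ʳ zero
    ≡⟨ cong (λ z → zero ∷ z ∷ʳ zero) (map-++ suc (shift d) [ zero ]) ⟩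
  zero ∷ (shift (shift d) ++ [ suc zero ]) ∷ʳ zero
    ≡⟨ cong (zero ∷_) (++-assoc (shift (shift d)) _ _) ⟩
  zero ∷ shift (shift d) ++ suc zero ∷ zero ∷ []
    ≈⟨ ++-congʳ (suc zero ∷ zero ∷ []) (zero-comm-shift² d) ⟩
  shift (shift d) ∷ʳ zero ++ suc zero ∷ zero ∷ []
    ≡⟨ ++-assoc (shift (shift d)) _ _ ⟩
  shift (shift d) ++ zero ∷ suc zero ∷ zero ∷ []
    ≈⟨ ++-congˡ (shift (shift d)) (braid refl) ⟩
  shift (shift d) ++ suc zero ∷ zero ∷ suc zero ∷ []
    ≡⟨ ++-assoc (shift (shift d)) [ suc zero ] _ ⟨
  (shift (shift d) ++ [ suc zero ]) ++ zero ∷ suc zero ∷ []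
    ≡⟨ ++-assoc (shift (shift d) ++ [ suc zero ]) [ zero ] _ ⟨
  ((shift (shift d) ++ [ suc zero ]) ∷ʳ zero) ++ [ suc zero ]
    ≡⟨ cong (λ z → z ∷ʳ zero ++ [ suc zero ]) (map-++ suc (shift d) [ zero ]) ⟨
  shift (shift d ∷ʳ zero) ∷ʳ zero ++ [ suc zero ] ∎)
  where open SetoidReasoning W-setoid
        d = descent k
∷-descent {suc n} (suc i) (suc k) with l , v , e ← ∷-descent i k = suc l , shift v , (begin
  suc i ∷ shift (descent k) ∷ʳ zero
    ≈⟨ ++-congʳ [ zero ] (shift-cong e) ⟩
  shift (descent l ++ shift v) ∷ʳ zero
    ≡⟨ cong (_∷ʳ zero) (map-++ suc (descent l) (shift v)) ⟩
  (shift (descent l) ++ shift (shift v)) ∷ʳ zero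
    ≡⟨ ++-assoc (shift (descent l)) _ _ ⟩
  shift (descent l) ++ (shift (shift v) ∷ʳ zero)
    ≈⟨ ++-congˡ (shift (descent l)) (zero-comm-shift² v) ⟨
  shift (descent l) ++ zero ∷ shift (shift v)
    ≡⟨ ++-assoc (shift (descent l)) [ zero ] _ ⟨
  shift (descent l) ∷ʳ zero ++ shift (shift v) ∎)
  where open SetoidReasoning W-setoid

coset-decomposition : ∀ {n} (u : Word (suc n)) →
                      ∃[ k ] ∃[ v ] u ≈ descent k ++ shift v
coset-decomposition []      = zero , [] , ≈-refl
coset-decomposition (i ∷ u)
  with k , v , p ← coset-decomposition u
  with l , v′ , q ← ∷-descent i k = l , v′ ++ v , (begin
  i ∷ u                                ≈⟨ ++-congˡ [ i ] p ⟩
  i ∷ descent k ++ shift v             ≈⟨ ++-congʳ (shift v) q ⟩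
  (descent l ++ shift v′) ++ shift v   ≡⟨ ++-assoc (descent l) _ _ ⟩
  descent l ++ shift v′ ++ shift v     ≡⟨ cong (descent l ++_) (map-++ suc v′ v) ⟨
  descent l ++ shift (v′ ++ v)         ∎)
  where open SetoidReasoning W-setoid

⟦descent++shift⟧-zero : ∀ {n} (k : Fin (suc (suc n))) (v : Word n) →
                        ⟦ descent k ++ shift v ⟧ 0 ≡ toℕ k
⟦descent++shift⟧-zero k v =
  trans (⟦⟧-++ (descent k) (shift v) 0)
  (trans (cong ⟦ descent k ⟧ (⟦shift⟧-zero v)) (⟦descent⟧-zero k))

-- Induction on the rank: the image of 0 determines the coset representative, and once it is
-- cancelled the remaining factors come from words of one rank less with equal actions.
faithful : ∀ {n} {u v : Word n} → ⟦ u ⟧ ≗ ⟦ v ⟧ → u ≈ v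
faithful {zero}  {[]} {[]} _ = ≈-refl
faithful {suc n} {u}  {v}  e
  with k , u′ , p ← coset-decomposition u
  with l , v′ , q ← coset-decomposition v
  with refl ← toℕ-injective (trans (sym (⟦descent++shift⟧-zero k u′))
                (trans (sym (⟦⟧-cong p 0)) (trans (e 0)
                (trans (⟦⟧-cong q 0) (⟦descent++shift⟧-zero l v′)))))
  = ≈-trans p (≈-trans (++-congˡ (descent k) (shift-cong (faithful u′≗v′))) (≈-sym q))
  where
  u′≗v′ : ⟦ u′ ⟧ ≗ ⟦ v′ ⟧
  u′≗v′ a = ℕ.suc-injective (trans (sym (⟦shift⟧-suc u′ a))
    (trans (⟦⟧-injective (descent k) (trans (sym (⟦⟧-++ (descent k) (shift u′) (suc a)))
      (trans (sym (⟦⟧-cong p (suc a))) (trans (e (suc a))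
      (trans (⟦⟧-cong q (suc a)) (⟦⟧-++ (descent k) (shift v′) (suc a)))))))
    (⟦shift⟧-suc v′ a)))

-- The strong exchange property

reflection : ∀ {n} → Word n → Fin n → Word n
reflection g i = g ++ [ i ] ++ reverse g

reflection-∷ʳ : ∀ {n} (g : Word n) i → reflection (g ∷ʳ i) i ≈ reflection g i
reflection-∷ʳ g i = begin
  (g ∷ʳ i) ++ i ∷ reverse (g ∷ʳ i)     ≡⟨ cong (λ r → (g ∷ʳ i) ++ i ∷ r) (reverse-++ g [ i ]) ⟩
  (g ∷ʳ i) ++ i ∷ i ∷ reverse g        ≈⟨ ++-congˡ (g ∷ʳ i) (++-congʳ (reverse g) (involution i)) ⟩
  (g ∷ʳ i) ++ reverse g                ≡⟨ ++-assoc g [ i ] (reverse g) ⟩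
  g ++ i ∷ reverse g                   ∎
  where open SetoidReasoning W-setoid

reflection-involutive : ∀ {n} (g : Word n) i → reflection g i ++ reflection g i ≈ []
reflection-involutive g i = begin
  (g ++ i ∷ reverse g) ++ g ++ i ∷ reverse g   ≡⟨ ++-assoc g _ _ ⟩
  g ++ i ∷ reverse g ++ g ++ i ∷ reverse g     ≡⟨ cong (λ z → g ++ i ∷ z) (++-assoc (reverse g) g _) ⟨
  g ++ i ∷ (reverse g ++ g) ++ i ∷ reverse g
    ≈⟨ ++-congˡ g (++-congˡ [ i ] (++-congʳ (i ∷ reverse g) (++-reverseˡ g))) ⟩
  g ++ i ∷ i ∷ reverse g                       ≈⟨ ++-congˡ g (++-congʳ (reverse g) (involution i)) ⟩
  g ++ reverse g                               ≈⟨ ++-reverseʳ g ⟩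
  []                                           ∎
  where open SetoidReasoning W-setoid

-- For `f` the action of a word, this says that `i` is not a right descent of that word.
Ascends : (ℕ → ℕ) → ∀ {n} → Fin n → Set
Ascends f i = f (toℕ i) ℕ.< f (suc (toℕ i))

isReflection : ∀ {n} (g : Word n) i → IsReflection (reflection g i)
isReflection g i = g , i , ≈-reflexive (sym (++-assoc g [ i ] (reverse g)))

-- The words `g` and `g ∷ʳ i` give the same reflection, and exactly one of them ascends at `i`.
ascending-reflection : ∀ {n} {t : Word n} → IsReflection t →
  ∃[ g ] ∃[ i ] Ascends ⟦ g ⟧ i × t ≈ reflection g i
ascending-reflection (g , i , t≈)
  with t≈r ← ≈-trans t≈ (≈-reflexive (++-assoc g [ i ] (reverse g)))
  with ℕ.<-cmp (⟦ g ⟧ (toℕ i)) (⟦ g ⟧ (suc (toℕ i)))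
... | tri< lt _ _ = g , i , lt , t≈r
... | tri≈ _ eq _ = contradiction (⟦⟧-injective g eq) (ℕ.1+n≢n ∘ sym)
... | tri> _ _ gt = g ∷ʳ i , i , subst₂ ℕ._<_ (sym lower) (sym upper) gt ,
                    ≈-trans t≈r (≈-sym (reflection-∷ʳ g i))
  where
  lower = trans (⟦⟧-++ g [ i ] (toℕ i)) (cong ⟦ g ⟧ (swap-lower i))
  upper = trans (⟦⟧-++ g [ i ] (suc (toℕ i))) (cong ⟦ g ⟧ (swap-upper i))

-- A permutation taking the pair exchanged by `i` to the pair exchanged by `j` conjugates one
-- transposition into the other; faithfulness lifts this to the group.
conjugate-generator : ∀ {n} (h : Word n) i j →
  ⟦ h ⟧ (toℕ i) ≡ toℕ j → ⟦ h ⟧ (suc (toℕ i)) ≡ suc (toℕ j) → j ∷ h ≈ h ∷ʳ i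
conjugate-generator h i j p q = faithful λ k → trans (on k) (sym (⟦⟧-++ h [ i ] k))
  where
  on : ∀ k → swap j (⟦ h ⟧ k) ≡ ⟦ h ⟧ (swap i k)
  on k with k ℕ.≟ toℕ i | k ℕ.≟ suc (toℕ i)
  ... | yes refl | _ = trans (cong (swap j) p)
        (trans (swap-lower j) (trans (sym q) (cong ⟦ h ⟧ (sym (swap-lower i)))))
  ... | no _ | yes refl = trans (cong (swap j) q)
        (trans (swap-upper j) (trans (sym p) (cong ⟦ h ⟧ (sym (swap-upper i)))))
  ... | no k≢ | no k≢′ = trans
        (swap-fixes j (λ e → k≢ (⟦⟧-injective h (trans e (sym p))))
                      (λ e → k≢′ (⟦⟧-injective h (trans e (sym q)))))
        (cong ⟦ h ⟧ (sym (swap-fixes i k≢ k≢′)))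

-- Reading z from the right, there is a letter at which the images of the two
-- points exchanged by the reflection change order; it exchanges these images,
-- so multiplying by the reflection amounts to deleting it.
strong-exchange : ∀ {n} (z g : Word n) i → Ascends ⟦ g ⟧ i →
  ⟦ z ⟧ (⟦ g ⟧ (suc (toℕ i))) ℕ.< ⟦ z ⟧ (⟦ g ⟧ (toℕ i)) →
  ∃[ z′ ] z′ ⊆ z × length z ≡ suc (length z′) × z ≈ z′ ++ reflection g i
strong-exchange []      g i a<b b<a = contradiction b<a (ℕ.<-asym a<b)
strong-exchange (j ∷ z) g i a<b zb<za
  with ℕ.<-cmp (⟦ z ⟧ (⟦ g ⟧ (toℕ i))) (⟦ z ⟧ (⟦ g ⟧ (suc (toℕ i))))
... | tri≈ _ eq _ = contradiction zb<za (ℕ.<-irrefl (cong (swap j) (sym eq)))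
... | tri> _ _ gt with z′ , sub , len , e ← strong-exchange z g i a<b gt =
  j ∷ z′ , refl ∷ sub , cong suc len , ++-congˡ [ j ] e
... | tri< lt _ _ with p , q ← swap-inverts j lt zb<za =
  z , j ∷ˢ ⊆-refl , refl , (begin
    j ∷ z                          ≡⟨ ++-identityʳ (j ∷ z) ⟨
    (j ∷ z) ++ []                  ≈⟨ ++-congˡ (j ∷ z) (++-reverseʳ g) ⟨
    (j ∷ z) ++ g ++ reverse g      ≡⟨ cong (j ∷_) (++-assoc z g (reverse g)) ⟨
    (j ∷ z ++ g) ++ reverse g
      ≈⟨ ++-congʳ (reverse g) (conjugate-generator (z ++ g) i j
           (trans (⟦⟧-++ z g _) p) (trans (⟦⟧-++ z g _) q)) ⟩
    ((z ++ g) ++ [ i ]) ++ reverse g   ≡⟨ ++-assoc (z ++ g) _ _ ⟩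
    (z ++ g) ++ i ∷ reverse g          ≡⟨ ++-assoc z g _ ⟩
    z ++ reflection g i                ∎)
  where open SetoidReasoning W-setoid

-- If t does not invert a word z for v then it inverts every word for u = vt,
-- and a shortest one would lose a letter.
⟶-deletion : ∀ {n} {u v z : Word n} → u ⟶ v → z ≈ v → ∃[ z′ ] z′ ⊆ z × z′ ≈ u
⟶-deletion {u = u} {v} {z} ((t , t-refl , v≈ut) ,
                     (k , l , (ru , (ru≈u , _) , refl) , (rv , (rv≈v , rv-reduced) , refl) , k<l)) z≈v
  with g , i , a<b , t≈r ← ascending-reflection t-refl
  with ℕ.<-cmp (⟦ z ⟧ (⟦ g ⟧ (toℕ i))) (⟦ z ⟧ (⟦ g ⟧ (suc (toℕ i))))
... | tri≈ _ eq _ = contradiction (⟦⟧-injective g (⟦⟧-injective z eq)) (ℕ.1+n≢n ∘ sym)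
... | tri> _ _ gt with z′ , sub , _ , e ← strong-exchange z g i a<b gt =
  z′ , sub , ∙-cancelʳ _ _ _ (≈-trans (≈-sym e) (≈-trans z≈v
    (≈-trans v≈ut (++-congˡ u t≈r))))
... | tri< lt _ _ = contradiction k<l (ℕ.≤⇒≯ (ℕ.≤-trans (rv-reduced ru′ ru′≈rv)
        (subst (length ru′ ℕ.≤_) (sym len) (ℕ.n≤1+n _))))
  where
  r = reflection g i
  ru≈zr : ru ≈ z ++ r
  ru≈zr = begin
    ru                ≈⟨ ru≈u ⟩
    u                 ≡⟨ ++-identityʳ u ⟨
    u ++ []           ≈⟨ ++-congˡ u (reflection-involutive g i) ⟨
    u ++ r ++ r       ≡⟨ ++-assoc u r r ⟨
    (u ++ r) ++ r     ≈⟨ ++-congʳ r (≈-trans (++-congˡ u (≈-sym t≈r))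
                                             (≈-trans (≈-sym v≈ut) (≈-sym z≈v))) ⟩
    z ++ r            ∎
    where open SetoidReasoning W-setoid
  swapped : ∀ {k l} → swap i k ≡ l → ⟦ ru ⟧ (⟦ g ⟧ k) ≡ ⟦ z ⟧ (⟦ g ⟧ l)
  swapped {k} refl = begin
    ⟦ ru ⟧ (⟦ g ⟧ k)           ≡⟨ ⟦⟧-++ ru g k ⟨
    ⟦ ru ++ g ⟧ k              ≡⟨ ⟦⟧-cong ru++g≈ k ⟩
    ⟦ z ++ g ++ [ i ] ⟧ k      ≡⟨ ⟦⟧-++ z (g ++ [ i ]) k ⟩
    ⟦ z ⟧ (⟦ g ++ [ i ] ⟧ k)   ≡⟨ cong ⟦ z ⟧ (⟦⟧-++ g [ i ] k) ⟩
    ⟦ z ⟧ (⟦ g ⟧ (swap i k))   ∎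
    where
    open ≡-Reasoning
    ru++g≈ : ru ++ g ≈ z ++ g ++ [ i ]
    ru++g≈ = SR.begin
      ru ++ g                               SR.≈⟨ ++-congʳ g ru≈zr ⟩
      (z ++ r) ++ g                         SR.≡⟨ ++-assoc z r g ⟩
      z ++ (g ++ i ∷ reverse g) ++ g        SR.≡⟨ cong (z ++_) (++-assoc g _ g) ⟩
      z ++ g ++ i ∷ reverse g ++ g          SR.≈⟨ ++-congˡ z (++-congˡ g (++-congˡ [ i ] (++-reverseˡ g))) ⟩
      z ++ g ++ [ i ]                       SR.∎
      where module SR = SetoidReasoning W-setoid
  shorter = strong-exchange ru g i a<b
    (subst₂ ℕ._<_ (sym (swapped (swap-upper i))) (sym (swapped (swap-lower i))) lt)
  ru′ = proj₁ shorter
  len = proj₁ (proj₂ (proj₂ shorter))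
  ru′≈rv : ru′ ≈ rv
  ru′≈rv = ∙-cancelʳ r ru′ rv (≈-trans (≈-sym (proj₂ (proj₂ (proj₂ shorter))))
    (≈-trans ru≈zr (++-congʳ r (≈-trans z≈v (≈-sym rv≈v)))))

infix 4 _≲_

-- This depends on `v` as a word, but on `u` only as a group element.
_≲_ : ∀ {n} → Word n → Word n → Set
u ≲ v = ∃[ u′ ] u′ ⊆ v × u′ ≈ u

-- One half of the subword property: going down the chain from its top, each reflection step passes
-- to a subword.
≤⇒≲ : ∀ {n} {u v : Word n} → u ≤ v → u ≲ v
≤⇒≲ (inj₁ u≈v) = _ , ⊆-refl , ≈-sym u≈v
≤⇒≲ (inj₂ ps)  = chain ps
  where
  chain : ∀ {n} {u v : Word n} → TransClosure _⟶_ u v → u ≲ v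
  chain ⁺.[ p ]  = ⟶-deletion p ≈-refl
  chain (p ∷ ps) with v′ , sub , e ← chain ps
                 with u′ , sub′ , e′ ← ⟶-deletion p e = u′ , ⊆-trans sub′ sub , e′

-- Criteria for reducedness

-- Every expression of the product inverts the pair exchanged by `i`, so strong exchange deletes a
-- letter from it and leaves an expression of `u`.
reduced-∷ʳ : ∀ {n} {u : Word n} {i} → Reduced u → Ascends ⟦ u ⟧ i → Reduced (u ∷ʳ i)
reduced-∷ʳ {u = u} {i} red up v v≈ui =
  subst₂ ℕ._≤_ (sym (trans (length-++ u) (ℕ.+-comm _ 1))) (sym len)
    (s≤s (red v′ (∙-cancelʳ _ _ _ (≈-trans (≈-sym v≈v′i) v≈ui))))
  where
  upper : ⟦ v ⟧ (suc (toℕ i)) ≡ ⟦ u ⟧ (toℕ i)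
  upper = trans (⟦⟧-cong v≈ui _) (trans (⟦⟧-++ u [ i ] _) (cong ⟦ u ⟧ (swap-upper i)))
  lower : ⟦ v ⟧ (toℕ i) ≡ ⟦ u ⟧ (suc (toℕ i))
  lower = trans (⟦⟧-cong v≈ui _) (trans (⟦⟧-++ u [ i ] _) (cong ⟦ u ⟧ (swap-lower i)))
  -- With the empty conjugator the reflection is the generator `i` itself.
  shorter = strong-exchange v [] i (ℕ.n<1+n _) (subst₂ ℕ._<_ (sym upper) (sym lower) up)
  v′    = proj₁ shorter
  len   = proj₁ (proj₂ (proj₂ shorter))
  v≈v′i = proj₂ (proj₂ (proj₂ shorter))

-- f is the permutation given by the letters to the left of the word.
data Ascending {n} (f : ℕ → ℕ) : Word n → Set where
  []  : Ascending f []
  _∷_ : ∀ {i u} → Ascends f i → Ascending (f ∘ swap i) u → Ascending f (i ∷ u)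

ascending-++ : ∀ {n f} {u v : Word n} →
               Ascending f u → Ascending (f ∘ ⟦ u ⟧) v → Ascending f (u ++ v)
ascending-++ []       bs = bs
ascending-++ (a ∷ as) bs = a ∷ ascending-++ as bs

ascending-map : ∀ {n f f′} {u : Word n} → (∀ {a b} → f a ℕ.< f b → f′ a ℕ.< f′ b) →
                Ascending f u → Ascending f′ u
ascending-map h []       = []
ascending-map h (a ∷ as) = h a ∷ ascending-map h as

ascending-shift : ∀ {n f f′} {u : Word n} →
                  (∀ {a b} → f a ℕ.< f b → f′ (suc a) ℕ.< f′ (suc b)) →
                  Ascending f u → Ascending f′ (shift u)
ascending-shift h []       = []
ascending-shift h (a ∷ as) = h a ∷ ascending-shift h as

reduced-++ : ∀ {n} {p u : Word n} → Reduced p → Ascending ⟦ p ⟧ u → Reduced (p ++ u)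
reduced-++ {p = p} red []  = subst Reduced (sym (++-identityʳ p)) red
reduced-++ {p = p} red (_∷_ {i} {u} a as) = subst Reduced (++-assoc p [ i ] u)
  (reduced-++ (reduced-∷ʳ red a)
    (ascending-map (λ {x} {y} → subst₂ ℕ._<_ (sym (⟦⟧-++ p [ i ] x)) (sym (⟦⟧-++ p [ i ] y))) as))

ascending⇒reduced : ∀ {n} {u : Word n} → Ascending id u → Reduced u
ascending⇒reduced = reduced-++ {p = []} (λ _ _ → z≤n)

-- Inserting `i` before `v` amounts to right multiplication by the conjugate of `i` by the inverse
-- of `v`.
deletion-⟶ : ∀ {n} (u : Word n) i v →
             Reduced (u ++ v) → Reduced (u ++ i ∷ v) → u ++ v ⟶ u ++ i ∷ v
deletion-⟶ u i v r r′ = (reflection (reverse v) i , isReflection (reverse v) i , (begin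
    u ++ i ∷ v                                              ≈⟨ ++-congˡ u (++-congʳ (i ∷ v) (++-reverseʳ v)) ⟨
    u ++ (v ++ reverse v) ++ i ∷ v                          ≡⟨ cong (u ++_) (++-assoc v _ _) ⟩
    u ++ v ++ reverse v ++ i ∷ v                            ≡⟨ ++-assoc u v _ ⟨
    (u ++ v) ++ reverse v ++ i ∷ v                          ≡⟨ cong (λ z → (u ++ v) ++ reverse v ++ i ∷ z) (reverse-involutive v) ⟨
    (u ++ v) ++ reverse v ++ i ∷ reverse (reverse v)        ∎)) ,
  (_ , _ , (u ++ v , (≈-refl , r) , refl) , (u ++ i ∷ v , (≈-refl , r′) , refl) ,
   subst₂ ℕ._<_ (sym (length-++ u)) (sym (length-++ u)) (ℕ.+-monoʳ-< (length u) (ℕ.n<1+n _)))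
  where open SetoidReasoning W-setoid

-- The words of the interval

flag : ∀ {n} → Bool → Word (suc n)
flag true  = [ zero ]
flag false = []

-- Palindromes arise by iterating `wrap true true` from a single letter; varying the flags gives the
-- subwords that keep the middle letter.
wrap : ∀ {n} → Bool → Bool → Word n → Word (suc n)
wrap a b u = flag a ++ shift u ++ flag b

-- In element p S the letter sᵢ occurs on both sides of the letters sⱼ, j > i,
-- if i ∈ S; otherwise it occurs only once, on the left if p says true and on
-- the right if p says false.
element : ∀ {m} → Vec Bool m → Subset m → Word (suc m)
element []      []      = [ zero ]
element (d ∷ p) (s ∷ S) = wrap (d ∨ s) (not d ∨ s) (element p S)

⟦wrap⟧ : ∀ {n} a b (u : Word n) k →
         ⟦ wrap a b u ⟧ k ≡ ⟦ flag {n} a ⟧ (⟦ shift u ⟧ (⟦ flag {n} b ⟧ k))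
⟦wrap⟧ a b u k =
  trans (⟦⟧-++ (flag a) (shift u ++ flag b) k) (cong ⟦ flag a ⟧ (⟦⟧-++ (shift u) (flag b) k))

⟦wrap⟧-fixed : ∀ {n} a b (u : Word n) {k} → ⟦ flag {n} b ⟧ k ≡ 0 →
               ⟦ wrap a b u ⟧ k ≡ ⟦ flag {n} a ⟧ 0
⟦wrap⟧-fixed {n} a b u {k} e = trans (⟦wrap⟧ a b u k)
  (cong ⟦ flag {n} a ⟧ (trans (cong ⟦ shift u ⟧ e) (⟦shift⟧-zero u)))

-- The right flag brings `k` to 1, the shifted word takes 1 to at least 2 since `u` moves 0, and the
-- left flag can exchange only 0 and 1.
⟦wrap⟧-moved : ∀ {n} a b (u : Word n) {k} → 0 ℕ.< ⟦ u ⟧ 0 → ⟦ flag {n} b ⟧ k ≡ 1 →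
               2 ℕ.≤ ⟦ wrap a b u ⟧ k
⟦wrap⟧-moved a b u {k} pos e
  rewrite ⟦wrap⟧ a b u k | e | ⟦shift⟧-suc u 0 with ⟦ u ⟧ 0 | a
⟦wrap⟧-moved a b u () e | zero  | _
⟦wrap⟧-moved a b u _  e | suc _ | true  = s≤s (s≤s z≤n)
⟦wrap⟧-moved a b u _  e | suc _ | false = s≤s (s≤s z≤n)

-- This invariant lets both reducedness and injectivity pass through `wrap`.
0<⟦element⟧0 : ∀ {m} (p : Vec Bool m) S → 0 ℕ.< ⟦ element p S ⟧ 0
0<⟦element⟧0 []          []            = s≤s z≤n
0<⟦element⟧0 (true  ∷ p) (outside ∷ S) =
  subst (0 ℕ.<_) (sym (⟦wrap⟧-fixed true false (element p S) refl)) (s≤s z≤n)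
0<⟦element⟧0 (true  ∷ p) (inside  ∷ S) =
  ℕ.<⇒≤ (⟦wrap⟧-moved true true (element p S) (0<⟦element⟧0 p S) refl)
0<⟦element⟧0 (false ∷ p) (s       ∷ S) =
  ℕ.<⇒≤ (⟦wrap⟧-moved s true (element p S) (0<⟦element⟧0 p S) refl)

-- A left 0 keeps the order of the positive points, so the shifted letters still ascend. A right 0
-- ascends because 1 has been sent to 2 or more, and 0 to at most 1.
ascending-wrap : ∀ {n} a b (u : Word n) → 0 ℕ.< ⟦ u ⟧ 0 →
                 Ascending id u → Ascending id (wrap a b u)
ascending-wrap {n} a b u pos as =
  ascending-++ (left a) (ascending-++ (ascending-shift (mono a) as) (right b))
  where
  left : ∀ a → Ascending id (flag {n} a)
  left true  = s≤s z≤n ∷ []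
  left false = []
  mono : ∀ a {x y} → x ℕ.< y → ⟦ flag {n} a ⟧ (suc x) ℕ.< ⟦ flag {n} a ⟧ (suc y)
  mono true  {zero}  {suc y} _  = s≤s z≤n
  mono true  {suc x} {suc y} lt = s≤s lt
  mono false lt = s≤s lt
  bound : ∀ a {k} → 0 ℕ.< k → ⟦ flag {n} a ⟧ 0 ℕ.< ⟦ flag {n} a ⟧ (suc k)
  bound true  {suc k} _ = s≤s (s≤s z≤n)
  bound false         _ = s≤s z≤n
  right : ∀ b → Ascending (⟦ flag {n} a ⟧ ∘ ⟦ shift u ⟧) (flag {n} b)
  right false = []
  right true  = subst₂ (λ x y → ⟦ flag {n} a ⟧ x ℕ.< ⟦ flag {n} a ⟧ y)
    (sym (⟦shift⟧-zero u)) (sym (⟦shift⟧-suc u 0)) (bound a pos) ∷ []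

element-reduced : ∀ {m} (p : Vec Bool m) S → Reduced (element p S)
element-reduced p S = ascending⇒reduced (ascending p S)
  where
  ascending : ∀ {m} (p : Vec Bool m) S → Ascending id (element p S)
  ascending []      []      = s≤s z≤n ∷ []
  ascending (d ∷ p) (s ∷ S) =
    ascending-wrap (d ∨ s) (not d ∨ s) (element p S) (0<⟦element⟧0 p S) (ascending p S)

shift-injective : ∀ {n} {u v : Word n} → shift u ≈ shift v → u ≈ v
shift-injective {u = u} {v} e = faithful λ k →
  ℕ.suc-injective (trans (sym (⟦shift⟧-suc u k)) (trans (⟦⟧-cong e (suc k)) (⟦shift⟧-suc v k)))

flag-injective : ∀ {n} {a b} → ⟦ flag {n} a ⟧ 0 ≡ ⟦ flag {n} b ⟧ 0 → a ≡ b
flag-injective {a = true}  {true}  _ = refl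
flag-injective {a = false} {false} _ = refl

flag≱2 : ∀ {n} a → ¬ 2 ℕ.≤ ⟦ flag {n} a ⟧ 0
flag≱2 true  (s≤s ())
flag≱2 false ()

-- Of the images of 0 and 1 under wrap a b u, exactly one is at least 2; b can
-- be read off from which one it is, and a from the other one.
wrap-injective : ∀ {n} a b e f {u v : Word n} → 0 ℕ.< ⟦ u ⟧ 0 →
                 wrap a b u ≈ wrap e f v → a ≡ e × b ≡ f × u ≈ v
wrap-injective {n} a b e f {u} {v} pos eq = by-last-flag b f eq
  where
  cancel : ∀ a b → wrap a b u ≈ wrap a b v → u ≈ v
  cancel a b = shift-injective ∘ ∙-cancelʳ (flag b) _ _ ∘ ∙-cancelˡ (flag a) _ _
  first : ∀ {k} b f → ⟦ flag {n} b ⟧ k ≡ 0 → ⟦ flag {n} f ⟧ k ≡ 0 →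
          wrap a b u ≈ wrap e f v → a ≡ e
  first {k} b f p q eq = flag-injective {n}
    (trans (sym (⟦wrap⟧-fixed a b u p)) (trans (⟦⟧-cong eq k) (⟦wrap⟧-fixed e f v q)))
  impossible : ∀ {k} b f → ⟦ flag {n} b ⟧ k ≡ 1 → ⟦ flag {n} f ⟧ k ≡ 0 →
               ¬ wrap a b u ≈ wrap e f v
  impossible {k} b f p q eq = flag≱2 {n} e
    (subst (2 ℕ.≤_) (trans (⟦⟧-cong eq k) (⟦wrap⟧-fixed e f v q)) (⟦wrap⟧-moved a b u pos p))
  by-last-flag : ∀ b f → wrap a b u ≈ wrap e f v → a ≡ e × b ≡ f × u ≈ v
  by-last-flag true  true  eq with refl ← first {1} true true refl refl eq =
    refl , refl , cancel a true eq
  by-last-flag false false eq with refl ← first {0} false false refl refl eq =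
    refl , refl , cancel a false eq
  by-last-flag true  false eq = contradiction eq (impossible true false refl refl)
  by-last-flag false true  eq = contradiction eq (impossible false true refl refl)

-- Subwords and the Bruhat order on these words

⊆-++⁻ : ∀ {n} {w : Word n} u {v} → w ⊆ u ++ v →
        ∃[ u′ ] ∃[ v′ ] w ≡ u′ ++ v′ × u′ ⊆ u × v′ ⊆ v
⊆-++⁻ []      sub = [] , _ , refl , [] , sub
⊆-++⁻ (i ∷ u) (.i ∷ˢ sub) with u′ , v′ , e , p , q ← ⊆-++⁻ u sub =
  u′ , v′ , e , i ∷ˢ p , q
⊆-++⁻ (i ∷ u) (refl ∷ sub) with u′ , v′ , e , p , q ← ⊆-++⁻ u sub =
  i ∷ u′ , v′ , cong (i ∷_) e , refl ∷ p , q

⊆-shift⁻ : ∀ {n} {w} (u : Word n) → w ⊆ shift u → ∃[ u′ ] w ≡ shift u′ × u′ ⊆ u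
⊆-shift⁻ []      []           = [] , refl , []
⊆-shift⁻ (i ∷ u) (_ ∷ˢ sub)   with u′ , e , p ← ⊆-shift⁻ u sub = u′ , e , i ∷ˢ p
⊆-shift⁻ (i ∷ u) (refl ∷ sub) with u′ , e , p ← ⊆-shift⁻ u sub =
  i ∷ u′ , cong (suc i ∷_) e , refl ∷ p

⊆-flag⁻ : ∀ {n} {w} a → w ⊆ flag {n} a → ∃[ a′ ] w ≡ flag a′ × a′ ≤ᵇ a
⊆-flag⁻ true  (_ ∷ˢ [])   = false , refl , f≤t
⊆-flag⁻ true  (refl ∷ []) = true  , refl , b≤b
⊆-flag⁻ false []          = false , refl , b≤b

⊆-wrap⁻ : ∀ {n} {w} a b (u : Word n) → w ⊆ wrap a b u →
          ∃[ e ] ∃[ f ] ∃[ v ] w ≡ wrap e f v × e ≤ᵇ a × f ≤ᵇ b × v ⊆ u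
⊆-wrap⁻ a b u sub
  with _ , _ , refl , sub₁ , sub₂₃ ← ⊆-++⁻ (flag a) sub
  with _ , _ , refl , sub₂ , sub₃ ← ⊆-++⁻ (shift u) sub₂₃
  with e , refl , e≤a ← ⊆-flag⁻ a sub₁
  with v , refl , v⊆u ← ⊆-shift⁻ u sub₂
  with f , refl , f≤b ← ⊆-flag⁻ b sub₃
  = e , f , v , refl , e≤a , f≤b , v⊆u

-- A subword of a wrap is a wrap with smaller flags and a smaller core; `wrap-injective` identifies
-- these with the flags and core on the left.
wrap-≲⁻ : ∀ {n} a b e f {u v : Word n} → 0 ℕ.< ⟦ u ⟧ 0 →
          wrap a b u ≲ wrap e f v → a ≤ᵇ e × b ≤ᵇ f × u ≲ v
wrap-≲⁻ a b e f {u} {v} pos (w , sub , w≈)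
  with e′ , f′ , v′ , refl , e′≤e , f′≤f , v′⊆v ← ⊆-wrap⁻ e f v sub
  with refl , refl , u≈v′ ← wrap-injective a b e′ f′ {u} {v′} pos (≈-sym w≈)
  = e′≤e , f′≤f , v′ , v′⊆v , ≈-sym u≈v′

-- Exactly one of `d` and `not d` is false, and on that side the flag is `s` itself, so comparing
-- flags compares `s` with `s′`.
≲⇒⊆ : ∀ {m} (p : Vec Bool m) {S S′} → element p S ≲ element p S′ → S ⊆ˢ S′
≲⇒⊆ []      {[]}    {[]}      _ = id
≲⇒⊆ (d ∷ p) {s ∷ S} {s′ ∷ S′} le
  with d∨s≤ , ¬d∨s≤ , le′ ←
    wrap-≲⁻ (d ∨ s) (not d ∨ s) (d ∨ s′) (not d ∨ s′) {v = element p S′} (0<⟦element⟧0 p S) le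
  = cons d s s′ d∨s≤ ¬d∨s≤ (≲⇒⊆ p le′)
  where
  cons : ∀ d s s′ → d ∨ s ≤ᵇ d ∨ s′ → not d ∨ s ≤ᵇ not d ∨ s′ →
         ∀ {m} {S S′ : Subset m} → S ⊆ˢ S′ → s ∷ S ⊆ˢ s′ ∷ S′
  cons _     outside _       _  _  S⊆S′ = out⊆ S⊆S′
  cons _     inside  inside  _  _  S⊆S′ = in⊆in S⊆S′
  cons true  inside  outside _  () S⊆S′
  cons false inside  outside () _  S⊆S′

infix 4 _⋖_

-- The covering relation of the Boolean lattice, chosen because a cover corresponds to the insertion
-- of a single letter.
data _⋖_ : ∀ {m} → Subset m → Subset m → Set where
  here  : ∀ {m} {S : Subset m} → outside ∷ S ⋖ inside ∷ S
  there : ∀ {m s} {S S′ : Subset m} → S ⋖ S′ → s ∷ S ⋖ s ∷ S′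

⊆⇒⋖* : ∀ {m} {S S′ : Subset m} → S ⊆ˢ S′ → Star _⋖_ S S′
⊆⇒⋖* {S = []} {[]} _ = ε
⊆⇒⋖* {S = outside ∷ S} {outside ∷ S′} sub = Star.gmap (outside ∷_) there (⊆⇒⋖* (drop-∷-⊆ sub))
⊆⇒⋖* {S = outside ∷ S} {inside  ∷ S′} sub = here ◅ Star.gmap (inside ∷_) there (⊆⇒⋖* (drop-∷-⊆ sub))
⊆⇒⋖* {S = inside  ∷ S} {inside  ∷ S′} sub = Star.gmap (inside ∷_) there (⊆⇒⋖* (drop-∷-⊆ sub))
⊆⇒⋖* {S = inside  ∷ S} {outside ∷ S′} sub with () ← sub here

⋖⇒deletion : ∀ {m} (p : Vec Bool m) {S S′} → S ⋖ S′ →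
             ∃[ u ] ∃[ i ] ∃[ v ] element p S ≡ u ++ v × element p S′ ≡ u ++ i ∷ v
-- The new copy of 0 goes to the end opposite to the one prescribed by `p`.
⋖⇒deletion (true  ∷ p) (here {S = S}) = zero ∷ shift (element p S) , zero , [] , refl , refl
⋖⇒deletion (false ∷ p) (here {S = S}) = [] , zero , shift (element p S) ++ [ zero ] , refl , refl
⋖⇒deletion (d ∷ p) (there {s = s} S⋖S′) with u , i , v , e , e′ ← ⋖⇒deletion p S⋖S′ =
  flag (d ∨ s) ++ shift u , suc i , shift v ++ flag (not d ∨ s) ,
  trans (cong (wrap (d ∨ s) (not d ∨ s)) e) (split v) ,
  trans (cong (wrap (d ∨ s) (not d ∨ s)) e′) (split (i ∷ v))
  where
  split : ∀ v → wrap (d ∨ s) (not d ∨ s) (u ++ v) ≡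
                (flag (d ∨ s) ++ shift u) ++ shift v ++ flag (not d ∨ s)
  split v = trans (cong (λ z → flag (d ∨ s) ++ z ++ flag (not d ∨ s)) (map-++ suc u v))
    (trans (cong (flag (d ∨ s) ++_) (++-assoc (shift u) _ _)) (sym (++-assoc (flag (d ∨ s)) _ _)))

⊆⇒≤ : ∀ {m} (p : Vec Bool m) {S S′} → S ⊆ˢ S′ → element p S ≤ element p S′
⊆⇒≤ p sub = Star.fold (λ S S′ → element p S ≤ element p S′)
  (λ S⋖S′ → ≤-trans (inj₂ ⁺.[ ⋖⇒⟶ S⋖S′ ])) (inj₁ ≈-refl) (⊆⇒⋖* sub)
  where
  ⋖⇒⟶ : ∀ {S S′} → S ⋖ S′ → element p S ⟶ element p S′
  ⋖⇒⟶ {S} {S′} S⋖S′ with u , i , v , e , e′ ← ⋖⇒deletion p S⋖S′ =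
    subst₂ _⟶_ (sym e) (sym e′)
      (deletion-⟶ u i v (subst Reduced e (element-reduced p S))
                        (subst Reduced e′ (element-reduced p S′)))

-- The lower bound forces the flag prescribed by `d` and the middle letter to remain; the other flag
-- is free and becomes the entry of the subset.
subword-element : ∀ {m} (p : Vec Bool m) {v} → v ⊆ element p ⊤ → element p ⊥ ≲ v →
                  ∃[ S ] v ≡ element p S
subword-element [] (refl ∷ []) le = [] , refl
-- Without the middle letter the word is empty and fixes 0, whereas `element [] ⊥` sends 0 to 1.
subword-element [] (_ ∷ˢ []) (_ , [] , []≈) with () ← ⟦⟧-cong []≈ 0
subword-element (d ∷ p) sub le
  with e , f , v , refl , _ , _ , v⊆ ← ⊆-wrap⁻ (d ∨ true) (not d ∨ true) (element p ⊤) sub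
  with d≤e , ¬d≤f , le′ ←
    wrap-≲⁻ (d ∨ false) (not d ∨ false) e f {v = v} (0<⟦element⟧0 p ⊥) le
  with S , refl ← subword-element p v⊆ le′
  = cons d e f d≤e ¬d≤f
  where
  cons : ∀ d e f → d ∨ false ≤ᵇ e → not d ∨ false ≤ᵇ f →
         ∃[ S′ ] wrap e f (element p S) ≡ element (d ∷ p) S′
  cons true  true f    _ _ = f ∷ S , refl
  cons false e    true _ _ = e ∷ S , refl

-- For the full subset both flags are true at every layer, whatever `p` prescribes.
palindrome≡element⊤ : ∀ {m} (p : Vec Bool m) → palindrome m ≡ element p ⊤
palindrome≡element⊤ []              = refl
palindrome≡element⊤ {suc m} (d ∷ p) = begin
  map inject₁ (allFin (suc m)) ++ [ l ] ++ reverse (map inject₁ (allFin (suc m)))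
    ≡⟨ cong (λ z → z ++ [ l ] ++ reverse z) initial-suc ⟩
  zero ∷ shift I ++ [ l ] ++ reverse (zero ∷ shift I)
    ≡⟨ cong (λ z → zero ∷ shift I ++ l ∷ z) (unfold-reverse zero (shift I)) ⟩
  zero ∷ shift I ++ l ∷ reverse (shift I) ++ [ zero ]
    ≡⟨ cong (λ z → zero ∷ shift I ++ l ∷ z ++ [ zero ]) (reverse-map suc I) ⟨
  zero ∷ shift I ++ shift (fromℕ m ∷ reverse I) ++ [ zero ]
    ≡⟨ cong (zero ∷_) (++-assoc (shift I) _ _) ⟨
  zero ∷ (shift I ++ shift (fromℕ m ∷ reverse I)) ++ [ zero ]
    ≡⟨ cong (λ z → zero ∷ z ++ [ zero ]) (map-++ suc I _) ⟨
  wrap true true (palindrome m)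
    ≡⟨ cong (wrap true true) (palindrome≡element⊤ p) ⟩
  wrap true true (element p ⊤)
    ≡⟨ cong₂ (λ a b → wrap a b (element p ⊤)) (∨-zeroʳ d) (∨-zeroʳ (not d)) ⟨
  element (d ∷ p) ⊤ ∎
  where
  open ≡-Reasoning
  l = fromℕ (suc m)
  I = map inject₁ (allFin m)
  initial-suc : map inject₁ (allFin (suc m)) ≡ zero ∷ shift I
  initial-suc = cong (zero ∷_) (trans (map-tabulate suc inject₁)
    (sym (trans (cong shift (map-tabulate id inject₁)) (map-tabulate inject₁ suc))))

length-element : ∀ {m} (p : Vec Bool m) S → length (element p S) ≡ ∣ S ∣ + suc m
length-element [] [] = refl
length-element {suc m} (d ∷ p) (s ∷ S) = begin
  length (flag (d ∨ s) ++ shift (element p S) ++ flag (not d ∨ s))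
    ≡⟨ length-++ (flag (d ∨ s)) ⟩
  length (flag {suc m} (d ∨ s)) + length (shift (element p S) ++ flag (not d ∨ s))
    ≡⟨ cong (length (flag {suc m} (d ∨ s)) +_) (length-++-comm (shift (element p S)) _) ⟩
  length (flag {suc m} (d ∨ s)) + length (flag (not d ∨ s) ++ shift (element p S))
    ≡⟨ cong (length (flag {suc m} (d ∨ s)) +_) (length-++ (flag (not d ∨ s))) ⟩
  length (flag {suc m} (d ∨ s)) + (length (flag {suc m} (not d ∨ s)) + length (shift (element p S)))
    ≡⟨ cong (λ k → length (flag {suc m} (d ∨ s)) + (length (flag {suc m} (not d ∨ s)) + k))
         (trans (length-map suc (element p S)) (length-element p S)) ⟩
  length (flag {suc m} (d ∨ s)) + (length (flag {suc m} (not d ∨ s)) + (∣ S ∣ + suc m))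
    ≡⟨ letters d s ⟩
  ∣ s ∷ S ∣ + suc (suc m) ∎
  where
  open ≡-Reasoning
  letters : ∀ d s → length (flag {suc m} (d ∨ s)) + (length (flag {suc m} (not d ∨ s)) + (∣ S ∣ + suc m))
                    ≡ ∣ s ∷ S ∣ + suc (suc m)
  letters true  outside = sym (ℕ.+-suc _ _)
  letters false outside = sym (ℕ.+-suc _ _)
  letters true  inside  = cong suc (sym (ℕ.+-suc _ _))
  letters false inside  = cong suc (sym (ℕ.+-suc _ _))

-- Coxeter elements

Unique-resp-⊇ : ∀ {n} {u v : Word n} → u ⊆ v → Unique v → Unique u
Unique-resp-⊇ []           []       = []
Unique-resp-⊇ (_ ∷ˢ sub)   (_ ∷ un) = Unique-resp-⊇ sub un
Unique-resp-⊇ (refl ∷ sub) (i∉ ∷ un) = All-resp-⊆ sub i∉ ∷ Unique-resp-⊇ sub un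

unique-disjoint : ∀ {n} {i : Fin n} u {v} → Unique (u ++ v) → i ∈ u → i ∉ v
unique-disjoint (i ∷ u) (i∉ ∷ _)  (here refl) i∈v = All.lookup i∉ (∈-++⁺ʳ u i∈v) refl
unique-disjoint (_ ∷ u) (_  ∷ un) (there i∈u) i∈v = unique-disjoint u un i∈u i∈v

zero∉⇒shift : ∀ {n} {u : Word (suc n)} → zero ∉ u → ∃[ v ] u ≡ shift v
zero∉⇒shift {u = []}        _  = [] , refl
zero∉⇒shift {u = zero  ∷ u} 0∉ = contradiction (here refl) 0∉
zero∉⇒shift {u = suc i ∷ u} 0∉ with v , refl ← zero∉⇒shift (0∉ ∘ there) = i ∷ v , refl

suc∈⇒∈ : ∀ {n} {i : Fin n} u {v} → suc i ∈ shift u ++ zero ∷ shift v → i ∈ u ++ v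
suc∈⇒∈ u i∈ with ∈-++⁻ (shift u) i∈
... | inj₁ i∈u         with _ , j∈u , refl ← ∈-map⁻ suc i∈u = ∈-++⁺ˡ j∈u
... | inj₂ (there i∈v) with _ , j∈v , refl ← ∈-map⁻ suc i∈v = ∈-++⁺ʳ u j∈v

-- Since 0 commutes with every letter other than 1, it can be moved to one end
-- of the word, namely away from the letter 1.
coxeter-word : ∀ {m} (u : Word (suc m)) → Unique u → (∀ i → i ∈ u) →
               ∃[ p ] u ≈ element p ⊥
coxeter-word {zero} []                _ all with () ← all zero
coxeter-word {zero} (zero ∷ [])       _ _ = [] , ≈-refl
coxeter-word {zero} (zero ∷ zero ∷ u) ((0≢0 ∷ _) ∷ _) _ = contradiction refl 0≢0
coxeter-word {suc m} u un all
  with a , b , refl ← ∈-∃++ (all zero)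
  with a , refl ← zero∉⇒shift (λ 0∈a → unique-disjoint a un 0∈a (here refl))
  with b , refl ← zero∉⇒shift (λ 0∈b →
         unique-disjoint [ zero ] (Unique-resp-⊇ (++⁺ˡ (shift a) ⊆-refl) un) (here refl) 0∈b)
  with un′ ← Unique.map⁻ (subst Unique (sym (map-++ suc a b))
         (Unique-resp-⊇ (++⁺ (⊆-refl {x = shift a}) (zero ∷ˢ ⊆-refl)) un))
  with p , e ← coxeter-word (a ++ b) un′ (λ i → suc∈⇒∈ a (all (suc i)))
  -- The letter 1 of `u` is the letter 0 of `a ++ b`. The part not containing it becomes a double
  -- shift, which 0 can pass.
  with ∈-++⁻ a (suc∈⇒∈ a (all (suc zero)))
... | inj₁ 0∈a with b , refl ← zero∉⇒shift (unique-disjoint a un′ 0∈a) = false ∷ p , (begin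
    shift a ++ zero ∷ shift (shift b)        ≈⟨ ++-congˡ (shift a) (zero-comm-shift² b) ⟩
    shift a ++ shift (shift b) ++ [ zero ]   ≡⟨ ++-assoc (shift a) _ _ ⟨
    (shift a ++ shift (shift b)) ++ [ zero ] ≡⟨ cong (_++ [ zero ]) (map-++ suc a (shift b)) ⟨
    shift (a ++ shift b) ++ [ zero ]         ≈⟨ ++-congʳ [ zero ] (shift-cong e) ⟩
    shift (element p ⊥) ++ [ zero ]          ∎)
  where open SetoidReasoning W-setoid
... | inj₂ 0∈b with a , refl ← zero∉⇒shift (λ 0∈a → unique-disjoint a un′ 0∈a 0∈b) = true ∷ p , (begin
    shift (shift a) ++ zero ∷ shift b        ≡⟨ ++-assoc (shift (shift a)) [ zero ] _ ⟨
    (shift (shift a) ∷ʳ zero) ++ shift b     ≈⟨ ++-congʳ (shift b) (zero-comm-shift² a) ⟨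
    zero ∷ shift (shift a) ++ shift b        ≡⟨ cong (zero ∷_) (map-++ suc (shift a) b) ⟨
    zero ∷ shift (shift a ++ b)              ≈⟨ ++-congˡ [ zero ] (shift-cong e) ⟩
    zero ∷ shift (element p ⊥)               ≡⟨ cong (zero ∷_) (++-identityʳ _) ⟨
    zero ∷ shift (element p ⊥) ++ []         ∎)
  where open SetoidReasoning W-setoid

coxeter⇒element : ∀ {m} {x : Word (suc m)} → IsCoxeterElement x → ∃[ p ] x ≈ element p ⊥
coxeter⇒element (π , x≈)
  with p , e ← coxeter-word (tabulate (π ⟨$⟩ʳ_)) (Unique.tabulate⁺ (Injection.injective (↔⇒↣ π)))
                 (λ i → subst (_∈ tabulate (π ⟨$⟩ʳ_)) (inverseʳ π) (∈-tabulate⁺ {f = π ⟨$⟩ʳ_} (π ⟨$⟩ˡ i)))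
  = p , ≈-trans x≈ e

-- Full commutativity

-- Commutation moves preserve the sum of the letters, braid moves do not.
weight : ∀ {n} → Word n → ℕ
weight = sum ∘ map toℕ

weight-↭ : ∀ {n} {u v : Word n} → u ↭ v → weight u ≡ weight v
weight-↭ = sum-↭ ∘ ↭.map⁺ toℕ

weight-++ : ∀ {n} (u v : Word n) → weight (u ++ v) ≡ weight u + weight v
weight-++ u v = trans (cong sum (map-++ toℕ u v)) (sum-++ (map toℕ u) (map toℕ v))

weight-shift : ∀ {n} (u : Word n) → weight (shift u) ≡ length u + weight u
weight-shift []      = refl
weight-shift (i ∷ u) = cong suc (begin
  toℕ i + weight (shift u)         ≡⟨ cong (toℕ i +_) (weight-shift u) ⟩
  toℕ i + (length u + weight u)    ≡⟨ x∙yz≈y∙xz (toℕ i) (length u) (weight u) ⟩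
  length u + (toℕ i + weight u)    ∎)
  where open ≡-Reasoning

-- A braid move from i, i+1, i to i+1, i, i+1 yields such a word.
HeavierExpression : ∀ {n} → Word n → Set
HeavierExpression u = ∃[ v ] v ≈ u × length v ≡ length u × weight v ≡ suc (weight u)

-- An expression as long as a reduced one is reduced, so full commutativity would link the two by
-- moves that preserve the weight.
heavier⇒¬fullyCommutative : ∀ {n} {u w : Word n} → Reduced u → u ≈ w →
                            HeavierExpression u → ¬ FullyCommutative w
heavier⇒¬fullyCommutative {u = u} red u≈w (v , v≈u , len , heavier) fc =
  ℕ.1+n≢n (trans (sym heavier) (sym
    (Eq.gfold ≡.isEquivalence weight move-weight
      (fc u v (u≈w , red) (≈-trans v≈u u≈w , λ z z≈v →
        subst (ℕ._≤ length z) (sym len) (red z (≈-trans z≈v v≈u)))))))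
  where
  move-weight : ∀ {u v} → CommutationMove u v → weight u ≡ weight v
  move-weight (move u {i} {j} v _) = weight-↭ (↭.++⁺ˡ u (↭.swap i j ↭.refl))

-- The permutation `u↭` shows that bringing `u` to the braid pattern changed neither length nor
-- weight.
heavier-braid : ∀ {n} {u : Word (suc (suc n))} a b → u ≈ a ++ zero ∷ suc zero ∷ zero ∷ b →
                u ↭ a ++ zero ∷ suc zero ∷ zero ∷ b → HeavierExpression u
heavier-braid a b u≈ u↭ =
  a ++ suc zero ∷ zero ∷ suc zero ∷ b ,
  ≈-trans (++-congˡ a (++-congʳ b (≈-sym (braid refl)))) (≈-sym u≈) ,
  trans (length-++ a) (sym (trans (↭.↭-length u↭) (length-++ a))) ,
  trans (weight-++ a _) (trans (ℕ.+-suc _ _)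
    (cong suc (sym (trans (weight-↭ u↭) (weight-++ a _)))))

-- Shifting adds the length to the weight, so words of equal length keep their difference of
-- weights.
heavier-shift : ∀ {n} {u : Word n} → HeavierExpression u → HeavierExpression (shift u)
heavier-shift {u = u} (v , v≈u , len , heavier) =
  shift v , shift-cong v≈u ,
  trans (length-map suc v) (trans len (sym (length-map suc u))) ,
  trans (weight-shift v) (trans (cong₂ _+_ len heavier)
    (trans (ℕ.+-suc _ _) (cong suc (sym (weight-shift u)))))

heavier-++ : ∀ {n} (a b : Word n) {u} → HeavierExpression u → HeavierExpression (a ++ u ++ b)
heavier-++ a b {u} (v , v≈u , len , heavier) =
  a ++ v ++ b , ++-congˡ a (++-congʳ b v≈u) ,
  trans (length-++₃ v) (trans (cong (λ k → length a + (k + length b)) len) (sym (length-++₃ u))) ,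
  trans (weight-++₃ v) (trans (cong (λ k → weight a + (k + weight b)) heavier)
    (trans (ℕ.+-suc _ _) (cong suc (sym (weight-++₃ u)))))
  where
  length-++₃ : ∀ u → length (a ++ u ++ b) ≡ length a + (length u + length b)
  length-++₃ u = trans (length-++ a) (cong (length a +_) (length-++ u))
  weight-++₃ : ∀ u → weight (a ++ u ++ b) ≡ weight a + (weight u + weight b)
  weight-++₃ u = trans (weight-++ a _) (cong (weight a +_) (weight-++ u b))

-- The core has a single 1, at one of its ends. Its other letters are at least 2, so the outer 0 on
-- their side passes them and 0, 1, 0 appears.
heavier-wrap : ∀ {m} (p : Vec Bool m) → HeavierExpression (wrap true true (element p ⊥))
heavier-wrap []          = heavier-braid [] [] ≈-refl ↭.refl
heavier-wrap (true ∷ p) rewrite ++-identityʳ (shift (element p ⊥)) =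
  heavier-braid [] (shift (shift (element p ⊥)))
    (++-congˡ (zero ∷ [ suc zero ]) (≈-sym (zero-comm-shift² (element p ⊥))))
    (↭.prep zero (↭.prep (suc zero) (↭.↭-sym (↭.∷↭∷ʳ zero (shift (shift (element p ⊥)))))))
heavier-wrap (false ∷ p) = subst HeavierExpression (cong (zero ∷_) (sym regroup))
  (heavier-braid u []
    (≈-trans (++-congʳ (suc zero ∷ [ zero ]) (zero-comm-shift² (element p ⊥)))
             (≈-reflexive (++-assoc u _ _)))
    (↭.↭-sym (↭.shift zero u _)))
  where
  u = shift (shift (element p ⊥))
  regroup : shift (shift (element p ⊥) ++ [ zero ]) ++ [ zero ] ≡ u ++ suc zero ∷ [ zero ]
  regroup = trans (cong (_++ [ zero ]) (map-++ suc (shift (element p ⊥)) [ zero ]))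
                  (++-assoc u _ _)

-- The tail is examined first, so the recursion stops at the largest member of `S`, where the tail
-- is `⊥` and `heavier-wrap` applies.
heavier-element : ∀ {m} (p : Vec Bool m) S → S ≢ ⊥ → HeavierExpression (element p S)
heavier-element []      []      S≢⊥ = contradiction refl S≢⊥
heavier-element (d ∷ p) (s ∷ S) S≢⊥ with ≡-dec _≟ᵇ_ S ⊥
heavier-element (d ∷ p) (s ∷ S) S≢⊥ | no S≢⊥′ =
  heavier-++ (flag (d ∨ s)) (flag (not d ∨ s)) (heavier-shift (heavier-element p S S≢⊥′))
heavier-element (d     ∷ p) (outside ∷ S) S≢⊥ | yes refl = contradiction refl S≢⊥
heavier-element (true  ∷ p) (inside  ∷ S) S≢⊥ | yes refl = heavier-wrap p
heavier-element (false ∷ p) (inside  ∷ S) S≢⊥ | yes refl = heavier-wrap p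

-- The interval

module _ {m : ℕ} {x : Word (suc m)} (p : Vec Bool m) (x≈ : x ≈ element p ⊥) where

  bottom : ∀ S → x ≤ element p S
  bottom S = ≤-trans (inj₁ x≈) (⊆⇒≤ p (⊆-min S))

  top : ∀ S → element p S ≤ palindrome m
  top S = ≤-trans (⊆⇒≤ p (⊆-max S)) (inj₁ (≈-reflexive (sym (palindrome≡element⊤ p))))

  -- The upper bound gives a subword of the palindrome that represents `y`; the lower bound gives a
  -- subword of that one representing `x`.
  locate : ∀ {y} → x ≤ y → y ≤ palindrome m → ∃[ S ] y ≈ element p S
  locate x≤y y≤w
    with v , v⊆w , v≈y ← ≤⇒≲ y≤w
    with S , refl ← subword-element p (subst (v ⊆_) (palindrome≡element⊤ p) v⊆w)
           (≤⇒≲ (≤-trans (inj₁ (≈-sym x≈)) (≤-trans x≤y (inj₁ (≈-sym v≈y)))))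
    = S , ≈-sym v≈y

  interval≅subsets : Interval (Bruhat (suc m)) x (palindrome m) ≅ ⊆-poset m
  interval≅subsets = subset , record
    { isOrderMonomorphism = record
      { isOrderHomomorphism = record
        { cong = λ {y} {z} → cong′ y z
        ; mono = λ {y} {z} → mono y z
        }
      ; injective = λ {y} {z} e → ≈-trans (subset-≈ y)
          (≈-trans (≈-reflexive (cong (element p) e)) (≈-sym (subset-≈ z)))
      ; cancel = λ {y} {z} sub → ≤-trans (inj₁ (subset-≈ y))
          (≤-trans (⊆⇒≤ p sub) (inj₁ (≈-sym (subset-≈ z))))
      }
    -- The subset located for `z` is found by a search in `z` alone; comparing words in both
    -- directions shows that it is `S`.
    ; surjective = λ S → (element p S , bottom S , top S) , λ {z} z≈ →
        ⊆-antisym (≲⇒⊆ p (≤⇒≲ (inj₁ (≈-trans (≈-sym (subset-≈ z)) z≈))))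
                  (≲⇒⊆ p (≤⇒≲ (inj₁ (≈-trans (≈-sym z≈) (subset-≈ z)))))
    }
    where
    Element = Poset.Carrier (Interval (Bruhat (suc m)) x (palindrome m))
    subset : Element → Subset m
    subset (_ , x≤y , y≤w) = proj₁ (locate x≤y y≤w)
    subset-≈ : ∀ (y : Element) → proj₁ y ≈ element p (subset y)
    subset-≈ (_ , x≤y , y≤w) = proj₂ (locate x≤y y≤w)
    mono : ∀ (y z : Element) → proj₁ y ≤ proj₁ z → subset y ⊆ˢ subset z
    mono y z y≤z = ≲⇒⊆ p (≤⇒≲ (≤-trans (inj₁ (≈-sym (subset-≈ y)))
      (≤-trans y≤z (inj₁ (subset-≈ z)))))
    cong′ : ∀ (y z : Element) → proj₁ y ≈ proj₁ z → subset y ≡ subset z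
    cong′ y z y≈z = ⊆-antisym (mono y z (inj₁ y≈z)) (mono z y (inj₁ (≈-sym y≈z)))

  ¬fullyCommutative : ∀ y → x < y → y ≤ palindrome m → ¬ FullyCommutative y
  ¬fullyCommutative y (x≤y , x≉y) y≤w with S , y≈ ← locate x≤y y≤w =
    heavier⇒¬fullyCommutative (element-reduced p S) (≈-sym y≈)
      (heavier-element p S λ { refl → x≉y (≈-trans x≈ (≈-sym y≈)) })

palindrome-reduced : ∀ m → Reduced (palindrome m)
palindrome-reduced m = subst Reduced (sym (palindrome≡element⊤ left)) (element-reduced left ⊤)
  -- All vectors give the same word at `⊤`, so this choice is arbitrary.
  where left = replicate m true

length-palindrome : ∀ m → length (palindrome m) ≡ m + suc m
length-palindrome m = trans (cong length (palindrome≡element⊤ left))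
  (trans (length-element left ⊤) (cong (_+ suc m) (∣⊤∣≡n m)))
  where left = replicate m true

mainTheorem10 : ∀ (m : ℕ) →
    Reduced (palindrome m) ×
    (∀ (x : Word (suc m)) → IsCoxeterElement x →
    x ≤ palindrome m ×
    (∃[ k ] ∃[ l ] HasLength (palindrome m) k × HasLength x l ×
    Interval (Bruhat (suc m)) x (palindrome m) ≅ ⊆-poset (k ∸ l)) ×
    (∀ (y : Word (suc m)) → x < y → y ≤ palindrome m → ¬ FullyCommutative y))
mainTheorem10 m = palindrome-reduced m , λ x coxeter →
  let p , x≈ = coxeter⇒element coxeter in
  ≤-trans (bottom p x≈ ⊥) (top p x≈ ⊥) ,
  -- With n = m + 1 the lengths are 2n - 1 and n, so the rank is n - 1 = m.
  (m + suc m , suc m ,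
    (palindrome m , (≈-refl , palindrome-reduced m) , length-palindrome m) ,
    (element p ⊥ , (≈-sym x≈ , element-reduced p ⊥) ,
      trans (length-element p ⊥) (cong (_+ suc m) (∣⊥∣≡0 m))) ,
    subst (λ r → Interval (Bruhat (suc m)) x (palindrome m) ≅ ⊆-poset r)
      (sym (ℕ.m+n∸n≡m m (suc m))) (interval≅subsets p x≈)) ,
  ¬fullyCommutative p x≈
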